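{- Let $G$ be an infinite, connected, countable, locally finite $d$-regular graph. For any starting vertex and any initial port, the random basic walk on $G$ cycles with probability $1$.
   Context: Each undirected edge $\{v,w\}$ is regarded as two arcs $v\to w$ and $w\to v$. A labeling assigns, at each vertex $v$ of degree $\deg(v)$, the port numbers $1,\dots,\deg(v)$ bijectively to the arcs leaving $v$ (labels on $v\to w$ and $w\to v$ need not agree). In a random labeling these bijections are chosen uniformly at random, independently for different vertices. Given a labeling, a starting vertex $v_0$ and an initial port $\ell$, the basic walk leaves $v_0$ along the arc labeled $\ell$; thereafter, whenever it enters a vertex $v$ along an arc whose label is $i$, it leaves $v$ along the arc out of $v$ labeled $(i \bmod \deg(v))+1$. The random basic walk is the basic walk for a random labeling. The walk cycles if some arc is traversed twice in the same direction (equivalently, from some point on it is periodic and visits only finitely many vertices); it is transient otherwise. -}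

module Defs where

open import Data.Fin.Base using (Fin; toℕ)
open import Data.Fin.Properties using (nonZeroIndex)
open import Data.Integer.Base using (+_)
open import Data.List.Base using (List; map; foldr; upTo)
open import Data.List.Relation.Unary.All using (All)
open import Data.List.Relation.Unary.Unique.Propositional using (Unique)
open import Data.Maybe.Base using (Maybe; maybe′)
open import Data.Maybe.Relation.Unary.Any using (Any)
open import Data.Nat.Base using (ℕ; zero; suc; _<_; _!)
open import Data.Nat.DivMod using (_mod_)
open import Data.Nat.Properties using (_!≢0)
open import Data.Product.Base using (Σ; ∃; ∃-syntax; _×_; _,_; proj₁)
open import Data.Rational.Base as ℚ using (ℚ; 0ℚ; 1ℚ; _/_)
open import Function.Bundles using (_↔_; _↣_; Inverse)
open import Level using (0ℓ)
open import Relation.Binary.Core using (Rel)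
open import Relation.Binary.Construct.Closure.ReflexiveTransitive using (Star)
open import Relation.Binary.Definitions using (Symmetric; Irreflexive; Irrelevant)
open import Relation.Binary.PropositionalEquality.Core using (_≡_; _≗_)
open import Relation.Nullary.Negation.Core using (¬_)

open Inverse using (to; from)

Infinite : Set → Set
Infinite A = ¬ (∃[ n ] (A ↔ Fin n))

Countable : Set → Set
Countable A = A ↣ ℕ

-- Simple undirected graphs. Irrelevance of Adj makes an arc determined by its
-- two endpoints, so there are no parallel edges.
record Graph : Set₁ where
  field
    V              : Set
    Adj            : Rel V 0ℓ
    Adj-sym        : Symmetric Adj
    Adj-irrefl     : Irreflexive _≡_ Adj
    Adj-irrelevant : Irrelevant Adj

  ArcFrom : V → Set
  ArcFrom v = ∃[ w ] Adj v w

  Arc : Set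
  Arc = ∃[ v ] ArcFrom v

  Connected : Set
  Connected = ∀ v w → Star Adj v w

  record LocallyFinite : Set where
    field
      deg  : V → ℕ
      arcs : ∀ v → ArcFrom v ↔ Fin (deg v)

module BasicWalk (G : Graph) (LF : Graph.LocallyFinite G) where

  open Graph G
  open LocallyFinite LF

  Regular : ℕ → Set
  Regular d = ∀ v → deg v ≡ d

  -- k : Fin (deg v) stands for the port number toℕ k + 1.
  Ports : V → Set
  Ports v = ArcFrom v ↔ Fin (deg v)

  Labeling : Set
  Labeling = ∀ v → Ports v

  module _ (L : Labeling) where

    leave : (v : V) → Fin (deg v) → Arc
    leave v k = v , from (L v) k

    -- With ports shifted down by one, i ↦ (i mod deg v) + 1 becomes
    -- k ↦ (k + 1) mod deg v.  The degree of v is nonzero because the reverse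
    -- of the arc just traversed leaves v.
    next : Arc → Arc
    next (u , v , uv) = leave v (suc (toℕ (to (L u) (v , uv))) mod deg v)
      where instance _ = nonZeroIndex (to (L v) (u , Adj-sym uv))

    walk : (v₀ : V) → Fin (deg v₀) → ℕ → Arc
    walk v₀ ℓ zero    = leave v₀ ℓ
    walk v₀ ℓ (suc t) = next (walk v₀ ℓ t)

    Cycles : (v₀ : V) → Fin (deg v₀) → Set
    Cycles v₀ ℓ = ∃[ s ] ∃[ t ] (s < t × walk v₀ ℓ s ≡ walk v₀ ℓ t)

  -- The law of the random labeling is the product over v of the uniform
  -- measures on the (deg v)! elements of Ports v.  A cylinder prescribes the
  -- bijections at finitely many distinct vertices.
  record Cylinder : Set where
    field
      prescribed : List (Σ V Ports)
      distinct   : Unique (map proj₁ prescribed)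

  open Cylinder

  _∈ᶜ_ : Labeling → Cylinder → Set
  L ∈ᶜ C = All (λ (v , b) → to (L v) ≗ to b) (prescribed C)

  uniformMass : V → ℚ
  uniformMass v = (+ 1) / (deg v !)
    where instance _ = deg v !≢0

  prob : Cylinder → ℚ
  prob C = foldr (λ (v , _) p → uniformMass v ℚ.* p) 1ℚ (prescribed C)

  -- Countable families of cylinders; nothing is the empty event, so that
  -- finite families are included.
  Family : Set
  Family = ℕ → Maybe Cylinder

  _∈⋃_ : Labeling → Family → Set
  L ∈⋃ C = ∃[ n ] Any (L ∈ᶜ_) (C n)

  partialSum : Family → ℕ → ℚ
  partialSum C N = foldr (λ n s → maybe′ prob 0ℚ (C n) ℚ.+ s) 0ℚ (upTo N)

  -- Outer measure zero for the product measure: for every ε > 0 there is a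
  -- countable cover by cylinders of total probability at most ε.
  Null : (Labeling → Set) → Set
  Null A = ∀ ε → 0ℚ ℚ.< ε →
    ∃[ C ] ((∀ L → A L → L ∈⋃ C) × (∀ N → partialSum C N ℚ.≤ ε))

  WithProbabilityOne : (Labeling → Set) → Set
  WithProbabilityOne A = Null (λ L → ¬ A L)

{-# OPTIONS --safe #-}
module Submission where

-- In a d-regular graph the basic walk started with port ℓ uses port ℓ + t (mod d) at time t, so it
-- cycles as soon as it is twice at the same vertex at times congruent mod d.  Labels are revealed one
-- port at a time, when the walk needs them; an unrevealed port is uniform over the unused arcs.
-- A walk that has not cycled keeps discovering vertices, since a finite set of vertices has only
-- finitely many ports.  Suppose it discovers u at time t₁ + 1, coming from p, and name ports by the
-- times (mod d) at which they are due.  With probability at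
-- least d^-(2d-1) the following happens: every time the walk is at u with a port different from
-- t₁ - 1, it leaves for a neighbour w ≠ p and comes straight back; and when port t₁ - 1 of u is due,
-- it leads to p.  Then p is entered with port t₁ due, which has been used already: the walk cycles.
-- Port t₁ - 1 comes up after at most d - 1 excursions, because 2(d - 1) ≡ -2 (mod d).  Hence the walk
-- survives n discoveries with probability at most (1 - d^-(2d-1))ⁿ.

open import Data.Empty using (⊥-elim)
open import Data.Fin.Base using (Fin; toℕ)
open import Data.Fin.Properties as Fin using (nonZeroIndex; all?; any?)
open import Data.Integer.Base as ℤ using (+_)
import Data.Integer.Properties as ℤ
open import Data.List.Base using (List; []; _∷_; _++_; map; foldr; length; filter; concatMap; allFin; applyUpTo)
open import Data.List.Membership.Propositional using (_∈_; _∉_; find; lose)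
open import Data.List.Membership.Propositional.Properties
  using (∈-map⁺; ∈-map⁻; ∈-filter⁺; ∈-filter⁻; ∈-allFin; ∈-concatMap⁺; ∈-length)
import Data.List.Membership.DecPropositional as DecMembership
open import Data.List.Properties using (length-map; length-tabulate; length-filter)
open import Data.List.Relation.Unary.All as All using (All; []; _∷_)
open import Data.List.Relation.Unary.All.Properties using (¬Any⇒All¬)
open import Data.List.Relation.Unary.AllPairs using ([]; _∷_)
open import Data.List.Relation.Unary.Any as Any using (Any; here; there)
open import Data.List.Relation.Unary.Any.Properties using (++⁺ˡ; ++⁺ʳ)
open import Data.List.Relation.Unary.Unique.Propositional using (Unique)
open import Data.Maybe.Base using (just; nothing; maybe′)
import Data.Maybe.Relation.Unary.Any as Maybe
open import Data.Nat.Base as ℕ using (ℕ; zero; suc; z≤n; s≤s; NonZero; _!)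
open import Data.Nat.DivMod using (_%_; _mod_; %-distribˡ-+; %-congʳ; [m+n]%n≡m%n; m%n<n; m<n⇒m%n≡m; m%n%n≡m%n)
open import Data.Nat.ListAction using (sum)
import Data.Nat.Properties as ℕ
open import Data.Nat.Tactic.RingSolver using (solve-∀)
open import Data.Product.Base using (Σ; ∃-syntax; _×_; _,_; proj₁; proj₂)
open import Data.Rational.Base using (ℚ; 0ℚ; 1ℚ; _/_; _+_; _*_; _-_; -_; _≤_; _<_; mkℚ; nonNegative; positive; toℚᵘ; *<*)
open import Data.Rational.Properties hiding (_≟_)
open import Data.Rational.Solver using (module +-*-Solver)
open import Data.Rational.Unnormalised.Base as ℚᵘ using (mkℚᵘ; *≡*)
import Data.Rational.Unnormalised.Properties as ℚᵘ
open import Data.Sum.Base using (_⊎_; inj₁; inj₂; [_,_]′; map₂)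
open import Function.Base using (_∘_; id)
open import Function.Bundles using (Inverse; mk↔ₛ′)
open import Level using (0ℓ)
open import Relation.Binary.Definitions using (DecidableEquality)
open import Relation.Binary.PropositionalEquality
open import Relation.Nullary using (¬_; yes; no; ¬?; contradiction)
open import Relation.Nullary.Decidable using (via-injection)
open import Relation.Unary using (Pred; Decidable; _⊆_)
open import Defs

open +-*-Solver using (solve; _:=_; con; _:+_; _:*_; _:-_)
open Inverse using (to; from; strictlyInverseˡ; strictlyInverseʳ)

-- Rational arithmetic: naturals, reciprocals and powers of rationals.

-- Abstract, since unification would otherwise unfold the gcd computations in _/_.
abstract
  ι : ℕ → ℚ
  ι n = (+ n) / 1

  inv : ∀ n .{{_ : NonZero n}} → ℚ
  inv n = (+ 1) / n

  toℚᵘ-/ : ∀ i n .{{_ : NonZero n}} → toℚᵘ (i / n) ℚᵘ.≃ (i ℚᵘ./ n)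
  toℚᵘ-/ i (suc n) = toℚᵘ-fromℚᵘ (mkℚᵘ i n)

  ι-+ : ∀ m n → ι (m ℕ.+ n) ≡ ι m + ι n
  ι-+ m n = toℚᵘ-injective (begin
    toℚᵘ (ι (m ℕ.+ n))            ≈⟨ toℚᵘ-/ (+ (m ℕ.+ n)) 1 ⟩
    mkℚᵘ (+ (m ℕ.+ n)) 0          ≈⟨ *≡* (cong (ℤ._* + 1) (cong₂ ℤ._+_ (sym (ℤ.*-identityʳ (+ m))) (sym (ℤ.*-identityʳ (+ n))))) ⟩
    mkℚᵘ (+ m) 0 ℚᵘ.+ mkℚᵘ (+ n) 0 ≈⟨ ℚᵘ.+-cong (toℚᵘ-/ (+ m) 1) (toℚᵘ-/ (+ n) 1) ⟨
    toℚᵘ (ι m) ℚᵘ.+ toℚᵘ (ι n)    ≈⟨ toℚᵘ-homo-+ (ι m) (ι n) ⟨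
    toℚᵘ (ι m + ι n)              ∎)
    where open ℚᵘ.≃-Reasoning

  ι-* : ∀ m n → ι (m ℕ.* n) ≡ ι m * ι n
  ι-* m n = toℚᵘ-injective (begin
    toℚᵘ (ι (m ℕ.* n))            ≈⟨ toℚᵘ-/ (+ (m ℕ.* n)) 1 ⟩
    mkℚᵘ (+ (m ℕ.* n)) 0          ≈⟨ *≡* (cong (ℤ._* + 1) (ℤ.pos-* m n)) ⟩
    mkℚᵘ (+ m) 0 ℚᵘ.* mkℚᵘ (+ n) 0 ≈⟨ ℚᵘ.*-cong (toℚᵘ-/ (+ m) 1) (toℚᵘ-/ (+ n) 1) ⟨
    toℚᵘ (ι m) ℚᵘ.* toℚᵘ (ι n)    ≈⟨ toℚᵘ-homo-* (ι m) (ι n) ⟨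
    toℚᵘ (ι m * ι n)              ∎)
    where open ℚᵘ.≃-Reasoning

  ι-*-inv : ∀ n .{{_ : NonZero n}} → ι n * inv n ≡ 1ℚ
  ι-*-inv (suc n) = toℚᵘ-injective (begin
    toℚᵘ (ι (suc n) * inv (suc n))           ≈⟨ toℚᵘ-homo-* (ι (suc n)) (inv (suc n)) ⟩
    toℚᵘ (ι (suc n)) ℚᵘ.* toℚᵘ (inv (suc n)) ≈⟨ ℚᵘ.*-cong (toℚᵘ-/ (+ suc n) 1) (toℚᵘ-/ (+ 1) (suc n)) ⟩
    mkℚᵘ (+ suc n) 0 ℚᵘ.* mkℚᵘ (+ 1) n       ≈⟨ *≡* (trans (ℤ.*-identityʳ (+ suc n ℤ.* + 1))
                                                  (trans (ℤ.*-comm (+ suc n) (+ 1))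
                                                         (cong (λ x → + 1 ℤ.* + suc x) (sym (ℕ.+-identityʳ n))))) ⟩
    toℚᵘ 1ℚ                                  ∎)
    where open ℚᵘ.≃-Reasoning

  0≤ι : ∀ n → 0ℚ ≤ ι n
  0≤ι n = nonNegative⁻¹ (ι n) {{normalize-nonNeg n 1}}

  0≤inv : ∀ n .{{_ : NonZero n}} → 0ℚ ≤ inv n
  0≤inv n = nonNegative⁻¹ (inv n) {{normalize-nonNeg 1 n}}

  0<inv : ∀ n .{{_ : NonZero n}} → 0ℚ < inv n
  0<inv n = positive⁻¹ (inv n) {{normalize-pos 1 n}}

  ι0≡0 : ι 0 ≡ 0ℚ
  ι0≡0 = refl

  ι1≡1 : ι 1 ≡ 1ℚ
  ι1≡1 = refl

  inv-def : ∀ n .{{_ : NonZero n}} → inv n ≡ (+ 1) / n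
  inv-def n = refl

  ι-*-inv≡/ : ∀ m n .{{_ : NonZero n}} → ι m * inv n ≡ (+ m) / n
  ι-*-inv≡/ m n@(suc n-1) = toℚᵘ-injective (begin
    toℚᵘ (ι m * inv n)           ≈⟨ toℚᵘ-homo-* (ι m) (inv n) ⟩
    toℚᵘ (ι m) ℚᵘ.* toℚᵘ (inv n) ≈⟨ ℚᵘ.*-cong (toℚᵘ-/ (+ m) 1) (toℚᵘ-/ (+ 1) n) ⟩
    mkℚᵘ (+ m) 0 ℚᵘ.* mkℚᵘ (+ 1) n-1 ≈⟨ *≡* (cong₂ ℤ._*_ (ℤ.*-identityʳ (+ m)) (cong (λ y → + suc y) (sym (ℕ.+-identityʳ n-1)))) ⟩
    mkℚᵘ (+ m) n-1               ≈⟨ toℚᵘ-/ (+ m) n ⟨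
    toℚᵘ ((+ m) / n)             ∎)
    where open ℚᵘ.≃-Reasoning

ι-mono-≤ : ∀ {m n} → m ℕ.≤ n → ι m ≤ ι n
ι-mono-≤ {m} {n} m≤n = begin
  ι m                  ≡⟨ +-identityʳ (ι m) ⟨
  ι m + 0ℚ             ≤⟨ +-monoʳ-≤ (ι m) (0≤ι (n ℕ.∸ m)) ⟩
  ι m + ι (n ℕ.∸ m)    ≡⟨ ι-+ m (n ℕ.∸ m) ⟨
  ι (m ℕ.+ (n ℕ.∸ m))  ≡⟨ cong ι (ℕ.m+[n∸m]≡n m≤n) ⟩
  ι n                  ∎
  where open ≤-Reasoning

ι-suc : ∀ n → ι (suc n) ≡ 1ℚ + ι n
ι-suc n = trans (ι-+ 1 n) (cong (_+ ι n) ι1≡1)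

inv-antimono-≤ : ∀ {m n} .{{_ : NonZero m}} .{{_ : NonZero n}} → m ℕ.≤ n → inv n ≤ inv m
inv-antimono-≤ {m} {n} m≤n = begin
  inv n                    ≡⟨ *-identityʳ _ ⟨
  inv n * 1ℚ               ≡⟨ cong (inv n *_) (ι-*-inv m) ⟨
  inv n * (ι m * inv m)    ≡⟨ solve 3 (λ a b c → a :* (b :* c) := (b :* a) :* c) refl (inv n) (ι m) (inv m) ⟩
  ι m * inv n * inv m      ≤⟨ *-monoʳ-≤-nonNeg (inv m) {{nonNegative (0≤inv m)}}
                                (*-monoʳ-≤-nonNeg (inv n) {{nonNegative (0≤inv n)}} (ι-mono-≤ m≤n)) ⟩
  ι n * inv n * inv m      ≡⟨ cong (_* inv m) (ι-*-inv n) ⟩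
  1ℚ * inv m               ≡⟨ *-identityˡ _ ⟩
  inv m                    ∎
  where open ≤-Reasoning

inv≤1 : ∀ n .{{_ : NonZero n}} → inv n ≤ 1ℚ
inv≤1 n = ≤-trans (inv-antimono-≤ (ℕ.>-nonZero⁻¹ n)) (≤-reflexive (trans (sym (*-identityˡ (inv 1)))
  (trans (cong (_* inv 1) (sym ι1≡1)) (ι-*-inv 1))))

*-mono₂-≤ : ∀ {a b x y} → 0ℚ ≤ x → 0ℚ ≤ b → a ≤ b → x ≤ y → a * x ≤ b * y
*-mono₂-≤ {a} {b} {x} {y} 0≤x 0≤b a≤b x≤y =
  ≤-trans (*-monoʳ-≤-nonNeg x {{nonNegative 0≤x}} a≤b) (*-monoˡ-≤-nonNeg b {{nonNegative 0≤b}} x≤y)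

0≤* : ∀ {a b} → 0ℚ ≤ a → 0ℚ ≤ b → 0ℚ ≤ a * b
0≤* {a} {b} 0≤a 0≤b = nonNegative⁻¹ (a * b) {{nonNeg*nonNeg⇒nonNeg a {{nonNegative 0≤a}} b {{nonNegative 0≤b}}}}

0≤1 : 0ℚ ≤ 1ℚ
0≤1 = nonNegative⁻¹ 1ℚ

p-q≤p : ∀ {p q} → 0ℚ ≤ q → p - q ≤ p
p-q≤p {p} {q} 0≤q = begin
  p - q    ≤⟨ +-monoʳ-≤ p (neg-antimono-≤ 0≤q) ⟩
  p + - 0ℚ ≡⟨ +-identityʳ p ⟩
  p        ∎
  where open ≤-Reasoning

minus-antimonoʳ-≤ : ∀ p {q r} → q ≤ r → p - r ≤ p - q
minus-antimonoʳ-≤ p q≤r = +-monoʳ-≤ p (neg-antimono-≤ q≤r)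

0≤p-q : ∀ {p q} → q ≤ p → 0ℚ ≤ p - q
0≤p-q {p} {q} q≤p = begin
  0ℚ     ≡⟨ +-inverseʳ q ⟨
  q - q  ≤⟨ +-monoˡ-≤ (- q) q≤p ⟩
  p - q  ∎
  where open ≤-Reasoning

pow : ℚ → ℕ → ℚ
pow q zero    = 1ℚ
pow q (suc n) = pow q n * q

0≤pow : ∀ {q} n → 0ℚ ≤ q → 0ℚ ≤ pow q n
0≤pow zero    0≤q = 0≤1
0≤pow (suc n) 0≤q = 0≤* (0≤pow n 0≤q) 0≤q

pow≤1 : ∀ {q} n → 0ℚ ≤ q → q ≤ 1ℚ → pow q n ≤ 1ℚ
pow≤1 zero    0≤q q≤1 = ≤-refl
pow≤1 (suc n) 0≤q q≤1 = *-mono₂-≤ 0≤q 0≤1 (pow≤1 n 0≤q q≤1) q≤1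

0<pow : ∀ {q} n → 0ℚ < q → 0ℚ < pow q n
0<pow zero    0<q = positive⁻¹ 1ℚ
0<pow {q} (suc n) 0<q = positive⁻¹ (pow q n * q) {{pos*pos⇒pos (pow q n) {{positive (0<pow n 0<q)}} q {{positive 0<q}}}}

-- The denominator of `x` serves as `n`: the product is then the numerator, a positive integer.
archimedean : ∀ {x} → 0ℚ < x → ∃[ n ] (1ℚ ≤ ι n * x)
archimedean {x@(mkℚ (+ zero) _ _)} (*<* (ℤ.+<+ ()))
archimedean {x@(mkℚ (+ suc p) q _)} 0<x = suc q , (begin
  1ℚ                                      ≤⟨ ι1≤ ⟩
  ι (suc p)                               ≡⟨ *-identityʳ _ ⟨
  ι (suc p) * 1ℚ                          ≡⟨ cong (ι (suc p) *_) (ι-*-inv (suc q)) ⟨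
  ι (suc p) * (ι (suc q) * inv (suc q))   ≡⟨ solve 3 (λ a b c → a :* (b :* c) := b :* (a :* c)) refl (ι (suc p)) (ι (suc q)) (inv (suc q)) ⟩
  ι (suc q) * (ι (suc p) * inv (suc q))   ≡⟨ cong (ι (suc q) *_) (trans (ι-*-inv≡/ (suc p) (suc q)) (↥p/↧p≡p x)) ⟩
  ι (suc q) * x                           ∎)
  where
  open ≤-Reasoning
  ι1≤ : 1ℚ ≤ ι (suc p)
  ι1≤ = ≤-trans (≤-reflexive (sym ι1≡1)) (ι-mono-≤ (s≤s z≤n))
archimedean {x@(mkℚ (ℤ.-[1+ _ ]) _ _)} (*<* ())

-- This is the bound (1 - δ)ⁿ ≤ 1 / (1 + nδ) without division. The induction step rests on (1 - δ)(1
-- + (n + 1)δ) = 1 + nδ - (n + 1)δ² ≤ 1 + nδ.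
pow-bernoulli : ∀ {δ} → 0ℚ ≤ δ → δ ≤ 1ℚ → ∀ n → pow (1ℚ - δ) n * (1ℚ + ι n * δ) ≤ 1ℚ
pow-bernoulli {δ} 0≤δ δ≤1 zero    = ≤-reflexive (trans (*-identityˡ (1ℚ + ι 0 * δ))
  (trans (cong (λ x → 1ℚ + x) (trans (cong (_* δ) ι0≡0) (*-zeroˡ δ))) (+-identityʳ 1ℚ)))
pow-bernoulli {δ} 0≤δ δ≤1 (suc n) = begin
  pow (1ℚ - δ) n * (1ℚ - δ) * (1ℚ + ι (suc n) * δ)
    ≡⟨ cong (λ x → pow (1ℚ - δ) n * (1ℚ - δ) * (1ℚ + x * δ)) (ι-suc n) ⟩
  pow (1ℚ - δ) n * (1ℚ - δ) * (1ℚ + (1ℚ + ι n) * δ)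
    ≡⟨ solve 3 (λ p m x → p :* (con 1ℚ :- x) :* (con 1ℚ :+ (con 1ℚ :+ m) :* x) :=
                           p :* (con 1ℚ :+ m :* x :- (con 1ℚ :+ m) :* (x :* x))) refl (pow (1ℚ - δ) n) (ι n) δ ⟩
  pow (1ℚ - δ) n * (1ℚ + ι n * δ - (1ℚ + ι n) * (δ * δ))
    ≤⟨ *-monoˡ-≤-nonNeg (pow (1ℚ - δ) n) {{nonNegative (0≤pow n (0≤p-q δ≤1))}}
         (p-q≤p (0≤* (+-mono-≤ 0≤1 (0≤ι n)) (0≤* 0≤δ 0≤δ))) ⟩
  pow (1ℚ - δ) n * (1ℚ + ι n * δ)
    ≤⟨ pow-bernoulli 0≤δ δ≤1 n ⟩
  1ℚ ∎
  where open ≤-Reasoning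

pow-vanishes : ∀ {δ ε} → 0ℚ < δ → δ ≤ 1ℚ → 0ℚ < ε → ∃[ n ] (pow (1ℚ - δ) n ≤ ε)
pow-vanishes {δ} {ε} 0<δ δ≤1 0<ε with archimedean (positive⁻¹ (δ * ε) {{pos*pos⇒pos δ {{positive 0<δ}} ε {{positive 0<ε}}}})
... | n , 1≤nδε = n , (begin
  p               ≡⟨ *-identityʳ p ⟨
  p * 1ℚ          ≤⟨ *-monoˡ-≤-nonNeg p {{nonNegative 0≤p}} 1≤nδε ⟩
  p * (ι n * (δ * ε)) ≡⟨ solve 4 (λ a b c e → a :* (b :* (c :* e)) := a :* (b :* c) :* e) refl p (ι n) δ ε ⟩
  p * (ι n * δ) * ε ≤⟨ *-monoʳ-≤-nonNeg ε {{nonNegative (<⇒≤ 0<ε)}}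
                         (≤-trans (*-monoˡ-≤-nonNeg p {{nonNegative 0≤p}} le) (pow-bernoulli (<⇒≤ 0<δ) δ≤1 n)) ⟩
  1ℚ * ε          ≡⟨ *-identityˡ ε ⟩
  ε               ∎)
  where
  open ≤-Reasoning
  p : ℚ
  p = pow (1ℚ - δ) n
  0≤p : 0ℚ ≤ p
  0≤p = 0≤pow n (0≤p-q δ≤1)
  le : ι n * δ ≤ 1ℚ + ι n * δ
  le = ≤-trans (≤-reflexive (sym (+-identityˡ (ι n * δ)))) (+-monoˡ-≤ (ι n * δ) 0≤1)

-- Counting in filtered lists, and factorials.

module _ {A : Set} {P Q : Pred A 0ℓ} (P? : Decidable P) (Q? : Decidable Q) (P⊆Q : P ⊆ Q) where

  length-filter-mono : ∀ xs → length (filter P? xs) ℕ.≤ length (filter Q? xs)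
  length-filter-mono []       = z≤n
  length-filter-mono (x ∷ xs) with P? x | Q? x
  ... | yes _ | yes _ = s≤s (length-filter-mono xs)
  ... | yes p | no ¬q = contradiction (P⊆Q p) ¬q
  ... | no _  | yes _ = ℕ.m≤n⇒m≤1+n (length-filter-mono xs)
  ... | no _  | no _  = length-filter-mono xs

  length-filter-strict : ∀ {x xs} → x ∈ xs → Q x → ¬ P x → length (filter P? xs) ℕ.< length (filter Q? xs)
  length-filter-strict {x} {_ ∷ xs} (here refl) q ¬p with P? x | Q? x
  ... | yes p | _     = contradiction p ¬p
  ... | no _  | yes _ = s≤s (length-filter-mono xs)
  ... | no _  | no ¬q = contradiction q ¬q
  length-filter-strict {x} {y ∷ xs} (there x∈xs) q ¬p with P? y | Q? y
  ... | yes _ | yes _ = s≤s (length-filter-strict x∈xs q ¬p)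
  ... | yes p | no ¬q = contradiction (P⊆Q p) ¬q
  ... | no _  | yes _ = ℕ.m≤n⇒m≤1+n (length-filter-strict x∈xs q ¬p)
  ... | no _  | no _  = length-filter-strict x∈xs q ¬p

!-mono-≤ : ∀ {m n} → m ℕ.≤ n → m ! ℕ.≤ n !
!-mono-≤ {m} {zero}  z≤n = ℕ.≤-refl
!-mono-≤ {m} {suc n} m≤1+n with ℕ.m≤n⇒m<n∨m≡n m≤1+n
... | inj₁ (s≤s m≤n) = ℕ.≤-trans (!-mono-≤ m≤n) (ℕ.m≤m+n (n !) (n ℕ.* n !))
... | inj₂ refl      = ℕ.≤-refl

*-!-≤ : ∀ {m n} → m ℕ.< n → n ℕ.* m ! ℕ.≤ n !
*-!-≤ {m} {suc n} (s≤s m≤n) = ℕ.*-monoʳ-≤ (suc n) (!-mono-≤ m≤n)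

-- Finite covers by cylinders.

module Covers (G : Graph) (LF : Graph.LocallyFinite G) where
  open Graph G
  open LocallyFinite LF
  open BasicWalk G LF
  open Cylinder

  total : List Cylinder → ℚ
  total = foldr (λ C p → prob C + p) 0ℚ

  total-++ : ∀ Cs Ds → total (Cs ++ Ds) ≡ total Cs + total Ds
  total-++ []       Ds = sym (+-identityˡ (total Ds))
  total-++ (C ∷ Cs) Ds = trans (cong (λ p → prob C + p) (total-++ Cs Ds)) (sym (+-assoc (prob C) (total Cs) (total Ds)))

  -- Stands for "`A` has probability at most `p`". Finite covers suffice, since whether the walk
  -- survives a given number of stages depends on finitely many labels.
  record Cover (A : Labeling → Set) (p : ℚ) : Set where
    constructor mkCover
    field
      cylinders : List Cylinder
      covers    : ∀ L → A L → Any (L ∈ᶜ_) cylinders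
      total≤    : total cylinders ≤ p

  open Cover

  cover-∅ : ∀ {A p} → (∀ L → ¬ A L) → 0ℚ ≤ p → Cover A p
  cover-∅ ¬A 0≤p = mkCover [] (λ L AL → contradiction AL (¬A L)) 0≤p

  cover-∪ : ∀ {A B p q} → Cover A p → Cover B q → Cover (λ L → A L ⊎ B L) (p + q)
  cover-∪ c d = mkCover (cylinders c ++ cylinders d)
    (λ L → [ ++⁺ˡ ∘ covers c L , ++⁺ʳ (cylinders c) ∘ covers d L ]′)
    (≤-trans (≤-reflexive (total-++ (cylinders c) (cylinders d))) (+-mono-≤ (total≤ c) (total≤ d)))

  cover-⊆ : ∀ {A B p q} → (∀ L → B L → A L) → p ≤ q → Cover A p → Cover B q
  cover-⊆ B⊆A p≤q c = mkCover (cylinders c) (λ L → covers c L ∘ B⊆A L) (≤-trans (total≤ c) p≤q)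

  module _ {X : Set} {A : X → Labeling → Set} where

    cover-⋃ : ∀ {p} xs → (∀ {x} → x ∈ xs → Cover (A x) p) →
              Cover (λ L → ∃[ x ] (x ∈ xs × A x L)) (ι (length xs) * p)
    cover-⋃ {p} []       cs = cover-∅ (λ { _ (_ , () , _) }) (≤-reflexive (sym (trans (cong (_* p) ι0≡0) (*-zeroˡ p))))
    cover-⋃ {p} (x ∷ xs) cs =
      cover-⊆ (λ { _ (_ , here refl , AL) → inj₁ AL ; _ (y , there y∈ , AL) → inj₂ (y , y∈ , AL) })
        (≤-reflexive (trans (solve 2 (λ a b → a :+ b :* a := (con 1ℚ :+ b) :* a) refl p (ι (length xs)))
                            (cong (_* p) (sym (ι-suc (length xs))))))
        (cover-∪ (cs (here refl)) (cover-⋃ xs (cs ∘ there)))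

    -- One member of the union has the bound `q` instead of `p`. The total is written as the uniform
    -- bound minus the saving `p - q`, the quantity that makes the survival probability shrink.
    cover-⋃-favoured : ∀ {p q x₀} {xs} → x₀ ∈ xs → Cover (A x₀) q → (∀ {x} → x ∈ xs → Cover (A x) p) →
              Cover (λ L → ∃[ x ] (x ∈ xs × A x L)) (ι (length xs) * p - (p - q))
    cover-⋃-favoured {p} {q} {x} {_ ∷ xs} (here refl) c₀ cs =
      cover-⊆ (λ { _ (_ , here refl , AL) → inj₁ AL ; _ (y , there y∈ , AL) → inj₂ (y , y∈ , AL) })
        (≤-reflexive (trans (solve 3 (λ a b c → c :+ b :* a := (con 1ℚ :+ b) :* a :- (a :- c)) refl p (ι (length xs)) q)
                            (cong (λ n → n * p - (p - q)) (sym (ι-suc (length xs))))))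
        (cover-∪ c₀ (cover-⋃ xs (cs ∘ there)))
    cover-⋃-favoured {p} {q} {x} {_ ∷ xs} (there x∈xs) c₀ cs =
      cover-⊆ (λ { _ (_ , here refl , AL) → inj₁ AL ; _ (y , there y∈ , AL) → inj₂ (y , y∈ , AL) })
        (≤-reflexive (trans (solve 3 (λ a b c → a :+ (b :* a :- (a :- c)) := (con 1ℚ :+ b) :* a :- (a :- c))
                              refl p (ι (length xs)) q)
                            (cong (λ n → n * p - (p - q)) (sym (ι-suc (length xs))))))
        (cover-∪ (cs (here refl)) (cover-⋃-favoured x∈xs c₀ (cs ∘ there)))

  family : List Cylinder → Family
  family []       _       = nothing
  family (C ∷ Cs) zero    = just C
  family (C ∷ Cs) (suc n) = family Cs n

  ∈⋃-family : ∀ L Cs → Any (L ∈ᶜ_) Cs → L ∈⋃ family Cs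
  ∈⋃-family L (C ∷ Cs) (here L∈C) = 0 , Maybe.just L∈C
  ∈⋃-family L (C ∷ Cs) (there L∈) with ∈⋃-family L Cs L∈
  ... | n , L∈n = suc n , L∈n

  0≤uniformMass : ∀ v → 0ℚ ≤ uniformMass v
  0≤uniformMass v = ≤-trans (0≤inv (deg v !) {{deg v ℕ.!≢0}}) (≤-reflexive (inv-def (deg v !) {{deg v ℕ.!≢0}}))

  0≤prob : ∀ C → 0ℚ ≤ prob C
  0≤prob C = go (prescribed C)
    where
    go : ∀ bs → 0ℚ ≤ foldr (λ (v , _) p → uniformMass v * p) 1ℚ bs
    go []             = 0≤1
    go ((v , _) ∷ bs) = 0≤* (0≤uniformMass v) (go bs)

  0≤total : ∀ Cs → 0ℚ ≤ total Cs
  0≤total []       = ≤-refl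
  0≤total (C ∷ Cs) = +-mono-≤ (0≤prob C) (0≤total Cs)

  private
    sumUpTo : (ℕ → ℚ) → (ℕ → ℕ) → ℕ → ℚ
    sumUpTo F f N = foldr (λ n s → F n + s) 0ℚ (applyUpTo f N)

    sumUpTo-suc : ∀ (F : ℕ → ℚ) f N → sumUpTo F (suc ∘ f) N ≡ sumUpTo (F ∘ suc) f N
    sumUpTo-suc F f zero    = refl
    sumUpTo-suc F f (suc N) = cong (λ s → F (suc (f 0)) + s) (sumUpTo-suc F (f ∘ suc) N)

  partialSum-family : ∀ Cs N → partialSum (family Cs) N ≤ total Cs
  partialSum-family Cs       zero    = 0≤total Cs
  partialSum-family []       (suc N) = ≤-reflexive (go id (suc N))
    where
    go : ∀ f N → sumUpTo (λ n → maybe′ prob 0ℚ (family [] n)) f N ≡ 0ℚ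
    go f zero    = refl
    go f (suc N) = trans (+-identityˡ _) (go (f ∘ suc) N)
  partialSum-family (C ∷ Cs) (suc N) = +-monoʳ-≤ (prob C)
    (≤-trans (≤-reflexive (sumUpTo-suc (λ n → maybe′ prob 0ℚ (family (C ∷ Cs) n)) id N)) (partialSum-family Cs N))

  null : ∀ {A} → (∀ ε → 0ℚ < ε → Cover A ε) → Null A
  null c ε 0<ε = family Cs , (λ L → ∈⋃-family L Cs ∘ covers (c ε 0<ε) L) ,
    (λ N → ≤-trans (partialSum-family Cs N) (total≤ (c ε 0<ε)))
    where
    Cs : List Cylinder
    Cs = cylinders (c ε 0<ε)

module Revealing (G : Graph) (LF : Graph.LocallyFinite G) (_≟_ : DecidableEquality (Graph.V G)) where
  open Graph G
  open LocallyFinite LF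
  open BasicWalk G LF
  open Covers G LF
  open Cylinder

  Slot : Set
  Slot = Σ V (Fin ∘ deg)

  Entry : Set
  Entry = Σ V λ v → Fin (deg v) × ArcFrom v

  slot : Entry → Slot
  slot (v , k , _) = v , k

  arc : Entry → Arc
  arc (v , _ , a) = v , a

  _⊨_ : Labeling → List Entry → Set
  L ⊨ σ = All (λ (v , k , a) → from (L v) k ≡ a) σ

  from-injective : ∀ (L : Labeling) v {j k} → from (L v) j ≡ from (L v) k → j ≡ k
  from-injective L v {j} {k} eq =
    trans (sym (strictlyInverseˡ (L v) j)) (trans (cong (to (L v)) eq) (strictlyInverseˡ (L v) k))

  _≟ᵃ_ : ∀ {v} → DecidableEquality (ArcFrom v)
  (w , vw) ≟ᵃ (w′ , vw′) with w ≟ w′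
  ... | yes refl = yes (cong (w ,_) (Adj-irrelevant vw vw′))
  ... | no w≢w′  = no (w≢w′ ∘ cong proj₁)

  _≟ᴬ_ : DecidableEquality Arc
  (v , a) ≟ᴬ (v′ , a′) with v ≟ v′
  ... | no v≢v′  = no (v≢v′ ∘ cong proj₁)
  ... | yes refl with a ≟ᵃ a′
  ...   | yes refl = yes refl
  ...   | no a≢a′  = no λ { refl → a≢a′ refl }

  _≟ˢ_ : DecidableEquality Slot
  (v , k) ≟ˢ (v′ , k′) with v ≟ v′
  ... | no v≢v′  = no (v≢v′ ∘ cong proj₁)
  ... | yes refl with k Fin.≟ k′
  ...   | yes refl = yes refl
  ...   | no k≢k′  = no λ { refl → k≢k′ refl }

  open DecMembership _≟_ public using () renaming (_∈?_ to _∈ⱽ?_)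
  open DecMembership _≟ᴬ_ using () renaming (_∈?_ to _∈ᴬ?_)
  open DecMembership _≟ˢ_ public using () renaming (_∈?_ to _∈ˢ?_)

  allArcs : ∀ v → List (ArcFrom v)
  allArcs v = map (from (arcs v)) (allFin (deg v))

  ∈-allArcs : ∀ {v} (a : ArcFrom v) → a ∈ allArcs v
  ∈-allArcs {v} a = subst (_∈ allArcs v) (strictlyInverseʳ (arcs v) a) (∈-map⁺ (from (arcs v)) (∈-allFin (to (arcs v) a)))

  Unused : List Entry → ∀ v → Pred (ArcFrom v) 0ℓ
  Unused σ v a = (v , a) ∉ map arc σ

  unused? : ∀ σ v → Decidable (Unused σ v)
  unused? σ v a = ¬? ((v , a) ∈ᴬ? map arc σ)

  unused : List Entry → ∀ v → List (ArcFrom v)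
  unused σ v = filter (unused? σ v) (allArcs v)

  ∈-unused : ∀ {σ v a} → Unused σ v a → a ∈ unused σ v
  ∈-unused {σ} {v} {a} = ∈-filter⁺ (unused? σ v) (∈-allArcs a)

  #unused : List Entry → V → ℕ
  #unused σ v = length (unused σ v)

  #unused≤deg : ∀ σ v → #unused σ v ℕ.≤ deg v
  #unused≤deg σ v = ℕ.≤-trans (length-filter (unused? σ v) (allArcs v))
    (ℕ.≤-reflexive (trans (length-map (from (arcs v)) (allFin (deg v))) (length-tabulate id)))

  #unused-mono : ∀ e σ v → #unused (e ∷ σ) v ℕ.≤ #unused σ v
  #unused-mono e σ v = length-filter-mono (unused? (e ∷ σ) v) (unused? σ v) (_∘ there) (allArcs v)

  #unused-strict : ∀ {σ v k a} → Unused σ v a → #unused ((v , k , a) ∷ σ) v ℕ.< #unused σ v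
  #unused-strict {σ} {v} {k} {a} un =
    length-filter-strict (unused? ((v , k , a) ∷ σ) v) (unused? σ v) (_∘ there) (∈-allArcs a) un (λ un′ → un′ (here refl))

  -- If the arc were used, `σ` would give it to some port of `v`; as labels are injective, that port
  -- would be `k`, which is new.
  label-unused : ∀ {L σ v k} → L ⊨ σ → (v , k) ∉ map slot σ → Unused σ v (from (L v) k)
  label-unused {L} {σ} {v} {k} Lσ new used with ∈-map⁻ arc used
  ... | (v , k′ , a) , e∈σ , refl = new (subst (λ j → (v , j) ∈ map slot σ) (from-injective L v (All.lookup Lσ e∈σ)) (∈-map⁺ slot e∈σ))

  -- The mass of a partial labeling.

  -- The number of ways to complete a consistent σ to full labelings of the vertices in S.
  completions : List V → List Entry → ℕ
  completions S σ = foldr (λ v n → #unused σ v ! ℕ.* n) 1 S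

  completions-mono : ∀ S e σ → completions S (e ∷ σ) ℕ.≤ completions S σ
  completions-mono []      e σ = ℕ.≤-refl
  completions-mono (v ∷ S) e σ = ℕ.*-mono-≤ (!-mono-≤ (#unused-mono e σ v)) (completions-mono S e σ)

  completions-reveal : ∀ {S σ v k a} → v ∈ S → Unused σ v a →
    #unused σ v ℕ.* completions S ((v , k , a) ∷ σ) ℕ.≤ completions S σ
  completions-reveal {v ∷ S} {σ} {k = k} {a} (here refl) un = begin
    r ℕ.* (r′ ! ℕ.* completions S σ′) ≡⟨ ℕ.*-assoc r (r′ !) _ ⟨
    r ℕ.* r′ ! ℕ.* completions S σ′   ≤⟨ ℕ.*-mono-≤ (*-!-≤ (#unused-strict {k = k} un)) (completions-mono S (v , k , a) σ) ⟩
    r ! ℕ.* completions S σ           ∎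
    where
    open ℕ.≤-Reasoning
    σ′ = (v , k , a) ∷ σ
    r  = #unused σ v
    r′ = #unused σ′ v
  completions-reveal {w ∷ S} {σ} {v} {k} {a} (there v∈S) un = begin
    r ℕ.* (#unused σ′ w ! ℕ.* c′) ≡⟨ ℕ.*-assoc r (#unused σ′ w !) c′ ⟨
    r ℕ.* #unused σ′ w ! ℕ.* c′   ≡⟨ cong (ℕ._* c′) (ℕ.*-comm r (#unused σ′ w !)) ⟩
    #unused σ′ w ! ℕ.* r ℕ.* c′   ≡⟨ ℕ.*-assoc (#unused σ′ w !) r c′ ⟩
    #unused σ′ w ! ℕ.* (r ℕ.* c′) ≤⟨ ℕ.*-mono-≤ (!-mono-≤ (#unused-mono (v , k , a) σ w)) (completions-reveal {k = k} v∈S un) ⟩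
    #unused σ w ! ℕ.* completions S σ ∎
    where
    open ℕ.≤-Reasoning
    σ′ = (v , k , a) ∷ σ
    r  = #unused σ v
    c′ = completions S σ′

  completions≥1 : ∀ S σ → 1 ℕ.≤ completions S σ
  completions≥1 []      σ = ℕ.≤-refl
  completions≥1 (v ∷ S) σ = ℕ.*-mono-≤ (ℕ.1≤n! (#unused σ v)) (completions≥1 S σ)

  unitMass : List V → ℚ
  unitMass = foldr (λ v p → uniformMass v * p) 1ℚ

  0≤unitMass : ∀ S → 0ℚ ≤ unitMass S
  0≤unitMass []      = 0≤1
  0≤unitMass (v ∷ S) = 0≤* (0≤uniformMass v) (0≤unitMass S)

  -- The probability that the random labeling satisfies σ, if S contains all vertices of σ; an upper
  -- bound for it in general.
  mass : List V → List Entry → ℚ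
  mass S σ = unitMass S * ι (completions S σ)

  0≤mass : ∀ S σ → 0ℚ ≤ mass S σ
  0≤mass S σ = 0≤* (0≤unitMass S) (0≤ι _)

  unitMass≤mass : ∀ S σ → unitMass S ≤ mass S σ
  unitMass≤mass S σ = ≤-trans (≤-reflexive (sym (*-identityʳ _)))
    (*-monoˡ-≤-nonNeg (unitMass S) {{nonNegative (0≤unitMass S)}} (≤-trans (≤-reflexive (sym ι1≡1)) (ι-mono-≤ (completions≥1 S σ))))

  mass-reveal : ∀ {S σ v k a} → v ∈ S → Unused σ v a → ι (#unused σ v) * mass S ((v , k , a) ∷ σ) ≤ mass S σ
  mass-reveal {S} {σ} {v} {k} {a} v∈S un = begin
    ι r * (unitMass S * ι c′)  ≡⟨ solve 3 (λ x y z → x :* (y :* z) := y :* (x :* z)) refl (ι r) (unitMass S) (ι c′) ⟩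
    unitMass S * (ι r * ι c′)  ≡⟨ cong (unitMass S *_) (sym (ι-* r c′)) ⟩
    unitMass S * ι (r ℕ.* c′)  ≤⟨ *-monoˡ-≤-nonNeg (unitMass S) {{nonNegative (0≤unitMass S)}} (ι-mono-≤ (completions-reveal {k = k} v∈S un)) ⟩
    mass S σ                   ∎
    where
    open ≤-Reasoning
    r  = #unused σ v
    c′ = completions S ((v , k , a) ∷ σ)

  mass-grow : ∀ v S σ → mass (v ∷ S) σ ≤ mass S σ
  mass-grow v S σ = begin
    uniformMass v * unitMass S * ι (#unused σ v ! ℕ.* c)    ≡⟨ cong (uniformMass v * unitMass S *_) (ι-* (#unused σ v !) c) ⟩
    uniformMass v * unitMass S * (ι (#unused σ v !) * ι c)
      ≡⟨ solve 4 (λ x y z w → x :* y :* (z :* w) := z :* x :* (y :* w)) refl (uniformMass v) (unitMass S) (ι (#unused σ v !)) (ι c) ⟩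
    ι (#unused σ v !) * uniformMass v * mass S σ
      ≤⟨ *-monoʳ-≤-nonNeg (mass S σ) {{nonNegative (0≤mass S σ)}}
           (*-monoʳ-≤-nonNeg (uniformMass v) {{nonNegative (0≤uniformMass v)}} (ι-mono-≤ (!-mono-≤ (#unused≤deg σ v)))) ⟩
    ι (deg v !) * uniformMass v * mass S σ                  ≡⟨ cong (_* mass S σ)
           (trans (cong (ι (deg v !) *_) (sym (inv-def (deg v !) {{deg v ℕ.!≢0}}))) (ι-*-inv (deg v !) {{deg v ℕ.!≢0}})) ⟩
    1ℚ * mass S σ                                           ≡⟨ *-identityˡ _ ⟩
    mass S σ                                                ∎
    where
    open ≤-Reasoning
    c = completions S σ

  -- From fully revealed vertices to cylinders.

  bijection? : ∀ {v} (f : Fin (deg v) → ArcFrom v) →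
    (Σ (Ports v) λ b → from b ≗ f) ⊎ (∀ (b : Ports v) → ¬ from b ≗ f)
  bijection? {v} f with all? (λ j → any? (λ k → f k ≟ᵃ from (arcs v) j))
  ... | no ¬sur = inj₂ λ b b≗f → ¬sur λ j → let a = from (arcs v) j in
          to b a , trans (sym (b≗f (to b a))) (strictlyInverseʳ b a)
  -- The surjectivity search yields a section `g` of `f`, so it remains to test whether `g` is also
  -- a left inverse.
  ... | yes sur with all? (λ k → g (f k) Fin.≟ k)
    where
    g : ArcFrom v → Fin (deg v)
    g a = proj₁ (sur (to (arcs v) a))
  ...   | no ¬inj = inj₂ λ b b≗f → ¬inj λ k → let j = proj₁ (sur (to (arcs v) (f k))) in
            trans (sym (strictlyInverseˡ b j))
           (trans (cong (to b) (trans (b≗f j) (trans (proj₂ (sur (to (arcs v) (f k))))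
             (trans (strictlyInverseʳ (arcs v) (f k)) (sym (b≗f k))))))
                  (strictlyInverseˡ b k))
  ...   | yes inj = inj₁ (mk↔ₛ′ (λ a → proj₁ (sur (to (arcs v) a))) f inj
            (λ a → trans (proj₂ (sur (to (arcs v) a))) (strictlyInverseʳ (arcs v) a)) , λ _ → refl)

  known-entry : ∀ {v k σ} → (v , k) ∈ map slot σ → ∃[ a ] (v , k , a) ∈ σ
  known-entry known with ∈-map⁻ slot known
  ... | (_ , _ , a) , e∈σ , refl = a , e∈σ

  Prescribes : List Entry → List (Σ V Ports) → Set
  Prescribes σ bs = ∀ L → L ⊨ σ → All (λ (v , b) → to (L v) ≗ to b) bs

  -- Consistency of `σ` is not assumed, so the entries read off at a vertex may fail to form a
  -- bijection; then no labeling satisfies `σ`.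
  prescribe : ∀ S {σ} → (∀ {v} → v ∈ S → ∀ k → (v , k) ∈ map slot σ) →
    (∃[ bs ] (map proj₁ bs ≡ S × Prescribes σ bs)) ⊎ (∀ L → ¬ L ⊨ σ)
  prescribe []      known = inj₁ ([] , refl , λ _ _ → [])
  prescribe (v ∷ S) {σ} known with prescribe S (known ∘ there)
              | bijection? (proj₁ ∘ known-entry ∘ known (here refl))
  ... | inj₂ none              | _         = inj₂ none
  ... | inj₁ _                 | inj₂ none = inj₂ λ L Lσ → none (L v) λ k →
    All.lookup Lσ (proj₂ (known-entry (known (here refl) k)))
  ... | inj₁ (bs , refl , agree) | inj₁ (b , b≗f) = inj₁ ((v , b) ∷ bs , refl , λ L Lσ →
    (λ a → trans (cong (to (L v)) (sym (trans
               (trans (All.lookup Lσ (proj₂ (known-entry (known (here refl) (to b a))))) (sym (b≗f (to b a))))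
               (strictlyInverseʳ b a))))
             (strictlyInverseˡ (L v) (to b a)))
    ∷ agree L Lσ)

  prob≡unitMass : ∀ (bs : List (Σ V Ports)) →
    foldr (λ (v , _) p → uniformMass v * p) 1ℚ bs ≡ unitMass (map proj₁ bs)
  prob≡unitMass []             = refl
  prob≡unitMass ((v , _) ∷ bs) = cong (uniformMass v *_) (prob≡unitMass bs)

  -- Conditional probability bounds.

  module Event (E : Labeling → Set) where

    -- E has probability at most q conditionally on σ, witnessed by a finite cover.
    record CondProb≤ (S : List V) (σ : List Entry) (q : ℚ) : Set where
      constructor cond
      field cover : Cover (λ L → L ⊨ σ × E L) (q * mass S σ)

    open CondProb≤ public

    cond-mono : ∀ {S σ p q} → p ≤ q → CondProb≤ S σ p → CondProb≤ S σ q
    cond-mono {S} {σ} p≤q (cond c) = cond (cover-⊆ (λ _ → id) (*-monoʳ-≤-nonNeg (mass S σ) {{nonNegative (0≤mass S σ)}} p≤q) c)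

    cond-grow : ∀ {v S σ q} → 0ℚ ≤ q → CondProb≤ (v ∷ S) σ q → CondProb≤ S σ q
    cond-grow {v} {S} {σ} {q} 0≤q (cond c) = cond (cover-⊆ (λ _ → id) (*-monoˡ-≤-nonNeg q {{nonNegative 0≤q}} (mass-grow v S σ)) c)

    cond-impossible : ∀ {S σ q} → 0ℚ ≤ q → (∀ L → L ⊨ σ → ¬ E L) → CondProb≤ S σ q
    cond-impossible {S} {σ} 0≤q ¬E = cond (cover-∅ (λ { L (Lσ , EL) → ¬E L Lσ EL }) (0≤* 0≤q (0≤mass S σ)))

    module _ {S σ v k} (v∈S : v ∈ S) (new : (v , k) ∉ map slot σ) where

      private
        split : ∀ L → L ⊨ σ × E L → ∃[ a ] (a ∈ unused σ v × (L ⊨ ((v , k , a) ∷ σ) × E L))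
        split L (Lσ , EL) = from (L v) k , ∈-unused (label-unused {L} Lσ new) , refl ∷ Lσ , EL

        share : .{{_ : NonZero (#unused σ v)}} → ℚ
        share = mass S σ * inv (#unused σ v)

        mass≤share : .{{_ : NonZero (#unused σ v)}} → ∀ {a} → Unused σ v a → mass S ((v , k , a) ∷ σ) ≤ share
        mass≤share {a} un = begin
          m                ≡⟨ *-identityʳ m ⟨
          m * 1ℚ           ≡⟨ cong (m *_) (ι-*-inv r) ⟨
          m * (ι r * inv r) ≡⟨ solve 3 (λ x y z → x :* (y :* z) := y :* x :* z) refl m (ι r) (inv r) ⟩
          ι r * m * inv r  ≤⟨ *-monoʳ-≤-nonNeg (inv r) {{nonNegative (0≤inv r)}} (mass-reveal {k = k} v∈S un) ⟩
          share            ∎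
          where
          open ≤-Reasoning
          r = #unused σ v
          m = mass S ((v , k , a) ∷ σ)

      cond-reveal-favoured : ∀ {d q e a₀} .{{_ : NonZero d}} → deg v ℕ.≤ d → 0ℚ ≤ q → 0ℚ ≤ e → e ≤ 1ℚ → Unused σ v a₀ →
        CondProb≤ S ((v , k , a₀) ∷ σ) (q * (1ℚ - e)) →
        (∀ {a} → Unused σ v a → CondProb≤ S ((v , k , a) ∷ σ) q) →
        CondProb≤ S σ (q * (1ℚ - e * inv d))
      cond-reveal-favoured {d} {q} {e} {a₀} deg≤d 0≤q 0≤e e≤1 un₀ c₀ cs = cond (
        cover-⊆ split bound (cover-⋃-favoured (∈-unused un₀)
          (cover-⊆ (λ _ → id) (*-monoˡ-≤-nonNeg (q * (1ℚ - e)) {{nonNegative (0≤* 0≤q (0≤p-q e≤1))}} (mass≤share un₀)) (cover c₀))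
          (λ a∈ → let un = proj₂ (∈-filter⁻ (unused? σ v) {xs = allArcs v} a∈) in
            cover-⊆ (λ _ → id) (*-monoˡ-≤-nonNeg q {{nonNegative 0≤q}} (mass≤share un)) (cover (cs un)))))
        where
        r = #unused σ v
        instance
          r≢0 : NonZero r
          r≢0 = ℕ.>-nonZero (∈-length (∈-unused un₀))
        M = mass S σ
        open ≤-Reasoning
        bound : ι r * (q * share) - (q * share - q * (1ℚ - e) * share) ≤ q * (1ℚ - e * inv d) * M
        bound = begin
          ι r * (q * (M * inv r)) - (q * (M * inv r) - q * (1ℚ - e) * (M * inv r))
            ≡⟨ solve 5 (λ R Q N I F → R :* (Q :* (N :* I)) :- (Q :* (N :* I) :- Q :* (con 1ℚ :- F) :* (N :* I))
                 := Q :* N :* (R :* I) :- (Q :* F :* N) :* I) refl (ι r) q M (inv r) e ⟩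
          q * M * (ι r * inv r) - q * e * M * inv r
            ≤⟨ minus-antimonoʳ-≤ (q * M * (ι r * inv r))
                 (*-monoˡ-≤-nonNeg (q * e * M) {{nonNegative (0≤* (0≤* 0≤q 0≤e) (0≤mass S σ))}}
                 (inv-antimono-≤ (ℕ.≤-trans (#unused≤deg σ v) deg≤d))) ⟩
          q * M * (ι r * inv r) - q * e * M * inv d
            ≡⟨ cong (λ x → q * M * x - q * e * M * inv d) (ι-*-inv r) ⟩
          q * M * 1ℚ - q * e * M * inv d
            ≡⟨ solve 4 (λ Q N F I → Q :* N :* con 1ℚ :- Q :* F :* N :* I := Q :* (con 1ℚ :- F :* I) :* N) refl q M e (inv d) ⟩
          q * (1ℚ - e * inv d) * M ∎

      cond-reveal : ∀ {q} → 0ℚ ≤ q → (∀ {a} → Unused σ v a → CondProb≤ S ((v , k , a) ∷ σ) q) → CondProb≤ S σ q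
      cond-reveal {q} 0≤q cs with unused σ v in eq
      ... | []     = cond-impossible 0≤q λ L Lσ EL → case (subst (_ ∈_) eq (proj₁ (proj₂ (split L (Lσ , EL)))))
        where
        case : ∀ {a} → ¬ (a ∈ [])
        case ()
      ... | a₀ ∷ _ = cond-mono (≤-reflexive (trans (cong (λ x → q * (1ℚ - x)) (*-zeroˡ (inv (suc (deg v))))) (*-identityʳ q)))
        -- No arc is favoured, so `e` is 0 and the saving vanishes for any `d`; `suc (deg v)` is a
        -- nonzero bound on the degree.
        (cond-reveal-favoured {suc (deg v)} {q} {0ℚ} (ℕ.n≤1+n (deg v)) 0≤q ≤-refl 0≤1 un₀
          (cond-mono (≤-reflexive (sym (*-identityʳ q))) (cs un₀)) cs)
        where
        un₀ : Unused σ v a₀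
        un₀ = proj₂ (∈-filter⁻ (unused? σ v) {xs = allArcs v} (subst (a₀ ∈_) (sym eq) (here refl)))

    cond-full : ∀ {S σ} → Unique S → (∀ {v} → v ∈ S → ∀ k → (v , k) ∈ map slot σ) → CondProb≤ S σ 1ℚ
    cond-full {S} {σ} uniq known with prescribe S known
    ... | inj₂ none = cond-impossible 0≤1 λ L Lσ _ → none L Lσ
    ... | inj₁ (bs , refl , agree) = cond (mkCover
      (C ∷ [])
      (λ L (Lσ , _) → here (agree L Lσ))
      (begin
        prob C + 0ℚ     ≡⟨ +-identityʳ (prob C) ⟩
        prob C          ≡⟨ prob≡unitMass bs ⟩
        unitMass S      ≤⟨ unitMass≤mass S σ ⟩
        mass S σ        ≡⟨ *-identityˡ _ ⟨
        1ℚ * mass S σ   ∎))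
      where
      open ≤-Reasoning
      C : Cylinder
      C = record { prescribed = bs ; distinct = uniq }

    -- Cylinders prescribe whole vertices, while `σ` may know only some of their ports. The missing
    -- ports of `S` are therefore revealed one by one, until each case is a single cylinder or
    -- impossible.
    cond-trivial : ∀ {S σ} → Unique S → CondProb≤ S σ 1ℚ
    cond-trivial {S} {σ} uniq = go slots λ v∈S k →
      inj₁ (∈-concatMap⁺ slotsAt (Any.map (λ { refl → ∈-map⁺ (_ ,_) (∈-allFin k) }) v∈S))
      where
      slotsAt : V → List Slot
      slotsAt v = map (v ,_) (allFin (deg v))

      slots : List Slot
      slots = concatMap slotsAt S

      go : ∀ todo {σ} → (∀ {v} → v ∈ S → ∀ k → (v , k) ∈ todo ⊎ (v , k) ∈ map slot σ) → CondProb≤ S σ 1ℚ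
      go []             rest = cond-full uniq λ v∈S k → [ (λ ()) , id ]′ (rest v∈S k)
      go ((v , k) ∷ todo) {σ} rest with v ∈ⱽ? S | (v , k) ∈ˢ? map slot σ
      ... | no v∉S  | _         = go todo λ v′∈S k′ → case (rest v′∈S k′) v′∈S
        where
        case : ∀ {v′ k′} → (v′ , k′) ∈ (v , k) ∷ todo ⊎ (v′ , k′) ∈ map slot σ → v′ ∈ S →
               (v′ , k′) ∈ todo ⊎ (v′ , k′) ∈ map slot σ
        case (inj₁ (here refl)) v∈S = contradiction v∈S v∉S
        case (inj₁ (there ∈t))  _   = inj₁ ∈t
        case (inj₂ ∈σ)          _   = inj₂ ∈σ
      ... | yes _   | yes known = go todo λ v′∈S k′ → case (rest v′∈S k′)
        where
        case : ∀ {s} → s ∈ (v , k) ∷ todo ⊎ s ∈ map slot σ → s ∈ todo ⊎ s ∈ map slot σ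
        case (inj₁ (here refl)) = inj₂ known
        case (inj₁ (there ∈t))  = inj₁ ∈t
        case (inj₂ ∈σ)          = inj₂ ∈σ
      ... | yes v∈S | no new    = cond-reveal v∈S new 0≤1 λ _ → go todo λ v′∈S k′ → case (rest v′∈S k′)
        where
        case : ∀ {s ss} → s ∈ (v , k) ∷ todo ⊎ s ∈ ss → s ∈ todo ⊎ s ∈ (v , k) ∷ ss
        case (inj₁ (here refl)) = inj₂ (here refl)
        case (inj₁ (there ∈t))  = inj₁ ∈t
        case (inj₂ ∈σ)          = inj₂ (there ∈σ)

-- Exploring the graph along the walk, with ports taken modulo d.

toℕ-mod : ∀ m n .{{_ : NonZero n}} → toℕ (m mod n) ≡ m % n
toℕ-mod m n = Fin.toℕ-fromℕ< (m%n<n m n)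

%-suc : ∀ m n d .{{_ : NonZero d}} → m % d ≡ n % d → suc m % d ≡ suc n % d
%-suc m n d eq = trans (%-distribˡ-+ 1 m d) (trans (cong (λ x → (1 % d ℕ.+ x) % d) eq) (sym (%-distribˡ-+ 1 n d)))

module Exploring (G : Graph) (LF : Graph.LocallyFinite G) (_≟_ : DecidableEquality (Graph.V G))
  (d′ : ℕ) (reg : BasicWalk.Regular G LF (suc d′))
  (v₀ : Graph.V G) (ℓ : Fin (Graph.LocallyFinite.deg LF v₀)) where

  open Graph G
  open LocallyFinite LF
  open BasicWalk G LF
  open Covers G LF
  open Revealing G LF _≟_

  d : ℕ
  d = suc d′

  NonCycling : Labeling → Set
  NonCycling L = ¬ Cycles L v₀ ℓ

  open Event NonCycling

  deg≢0 : ∀ v → NonZero (deg v)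
  deg≢0 v = subst NonZero (sym (reg v)) _

  port : ∀ v → ℕ → Fin (deg v)
  port v t = (toℕ ℓ ℕ.+ t) mod deg v
    where instance _ = deg≢0 v

  toℕ-port : ∀ v t → toℕ (port v t) ≡ (toℕ ℓ ℕ.+ t) % d
  toℕ-port v t = trans (toℕ-mod (toℕ ℓ ℕ.+ t) (deg v)) (%-congʳ (reg v))
    where instance _ = deg≢0 v

  port-cong : ∀ v {s t} → (toℕ ℓ ℕ.+ s) % d ≡ (toℕ ℓ ℕ.+ t) % d → port v s ≡ port v t
  port-cong v {s} {t} eq = Fin.toℕ-injective (trans (toℕ-port v s) (trans eq (sym (toℕ-port v t))))

  port-0 : port v₀ 0 ≡ ℓ
  port-0 = Fin.toℕ-injective (trans (toℕ-port v₀ 0) (trans (cong (_% d) (ℕ.+-identityʳ (toℕ ℓ)))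
    (m<n⇒m%n≡m (subst (toℕ ℓ ℕ.<_) (reg v₀) (Fin.toℕ<n ℓ)))))

  -- By regularity the modulus is the same at every vertex, so the port due depends on the time
  -- alone.
  next-port : ∀ L {v w} (vw : Adj v w) t → from (L v) (port v t) ≡ (w , vw) →
    next L (v , w , vw) ≡ leave L w (port w (suc t))
  next-port L {v} {w} vw t eq = cong (leave L w) (Fin.toℕ-injective (begin
    toℕ (suc (toℕ (to (L v) (w , vw))) mod deg w)  ≡⟨ toℕ-mod _ (deg w) ⟩
    suc (toℕ (to (L v) (w , vw))) % deg w          ≡⟨ %-congʳ (reg w) ⟩
    suc (toℕ (to (L v) (w , vw))) % d              ≡⟨ cong (λ a → suc (toℕ (to (L v) a)) % d) eq ⟨
    suc (toℕ (to (L v) (from (L v) (port v t)))) % d ≡⟨ cong (λ k → suc (toℕ k) % d) (strictlyInverseˡ (L v) (port v t)) ⟩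
    suc (toℕ (port v t)) % d                       ≡⟨ cong (λ k → suc k % d) (toℕ-port v t) ⟩
    suc ((toℕ ℓ ℕ.+ t) % d) % d                    ≡⟨ %-suc ((toℕ ℓ ℕ.+ t) % d) (toℕ ℓ ℕ.+ t) d (m%n%n≡m%n (toℕ ℓ ℕ.+ t) d) ⟩
    suc (toℕ ℓ ℕ.+ t) % d                          ≡⟨ cong (_% d) (sym (ℕ.+-suc (toℕ ℓ) t)) ⟩
    (toℕ ℓ ℕ.+ suc t) % d                          ≡⟨ toℕ-port w (suc t) ⟨
    toℕ (port w (suc t))                           ∎))
    where
    open ≡-Reasoning
    instance
      _ : NonZero (deg w)
      _ = nonZeroIndex (to (L w) (v , Adj-sym vw))

  target : Entry → V
  target (_ , _ , w , _) = w

  -- σ lists the labels read by the walk up to time t, when it is at v; S lists the vertices visited.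
  record State (S : List V) (σ : List Entry) (v : V) (t : ℕ) : Set where
    field
      uniq    : Unique S
      visited : v ∈ S
      sources : ∀ {e} → e ∈ σ → proj₁ e ∈ S
      targets : ∀ {e} → e ∈ σ → target e ∈ S
      current : ∀ L → L ⊨ σ → walk L v₀ ℓ t ≡ leave L v (port v t)
      past    : ∀ {v′ k a} → (v′ , k , a) ∈ σ → ∃[ s ] (s ℕ.< t × (∀ L → L ⊨ σ → walk L v₀ ℓ s ≡ leave L v′ k))

  open State

  initial : State (v₀ ∷ []) [] v₀ 0
  initial = record
    { uniq = [] ∷ [] ; visited = here refl ; sources = λ () ; targets = λ ()
    ; current = λ L _ → cong (leave L v₀) (sym port-0) ; past = λ () }

  extend : ∀ {S S′ σ v t} → State S σ v t → (a : ArcFrom v) → (∀ {w} → w ∈ S → w ∈ S′) → Unique S′ → proj₁ a ∈ S′ →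
    State S′ ((v , port v t , a) ∷ σ) (proj₁ a) (suc t)
  extend {t = t} st a@(w , vw) S⊆S′ uniq′ w∈S′ = record
    { uniq    = uniq′
    ; visited = w∈S′
    ; sources = λ { (here refl) → S⊆S′ (visited st) ; (there e∈σ) → S⊆S′ (sources st e∈σ) }
    ; targets = λ { (here refl) → w∈S′ ; (there e∈σ) → S⊆S′ (targets st e∈σ) }
    ; current = λ { L (eq ∷ Lσ) → trans (cong (next L) (trans (current st L Lσ) (cong (_ ,_) eq))) (next-port L vw t eq) }
    ; past    = λ { (here refl) → t , ℕ.≤-refl , (λ { L (_ ∷ Lσ) → current st L Lσ })
                  ; (there e∈σ) → let s , s<t , eq = past st e∈σ in
                      s , ℕ.m≤n⇒m≤1+n s<t , λ { L (_ ∷ Lσ) → eq L Lσ } }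
    }

  stay : ∀ {S σ v t} → State S σ v t → (a : ArcFrom v) → proj₁ a ∈ S → State S ((v , port v t , a) ∷ σ) (proj₁ a) (suc t)
  stay st a = extend st a id (uniq st)

  discover : ∀ {S σ v t} → State S σ v t → (a : ArcFrom v) → proj₁ a ∉ S →
    State (proj₁ a ∷ S) ((v , port v t , a) ∷ σ) (proj₁ a) (suc t)
  discover {S} st a w∉S = extend st a there (¬Any⇒All¬ S w∉S ∷ uniq st) (here refl)

  move : ∀ {S σ v t q} → State S σ v t → (a : ArcFrom v) → 0ℚ ≤ q →
    (∀ {S′} → State S′ ((v , port v t , a) ∷ σ) (proj₁ a) (suc t) → CondProb≤ S′ ((v , port v t , a) ∷ σ) q) →
    CondProb≤ S ((v , port v t , a) ∷ σ) q
  move {S} st a 0≤q c with proj₁ a ∈ⱽ? S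
  ... | yes w∈S = c (stay st a w∈S)
  ... | no w∉S  = cond-grow 0≤q (c (discover st a w∉S))

  -- The slot now due was read at an earlier time, so the walk is about to repeat an arc.
  cycled : ∀ {S σ v t q} → State S σ v t → 0ℚ ≤ q → (v , port v t) ∈ map slot σ → CondProb≤ S σ q
  cycled {t = t} st 0≤q known = cond-impossible 0≤q λ L Lσ ¬cyc →
    let _ , e∈σ = known-entry known ; s , s<t , eq = past st e∈σ in
    ¬cyc (s , t , s<t , trans (eq L Lσ) (sym (current st L Lσ)))

  0≤inv-d^ : ∀ j → 0ℚ ≤ pow (inv d) j
  0≤inv-d^ j = 0≤pow j (0≤inv d)

  inv-d^≤1 : ∀ j → pow (inv d) j ≤ 1ℚ
  inv-d^≤1 j = pow≤1 j (0≤inv d) (inv≤1 d)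

  -- Termination measure for the search for an undiscovered vertex.
  budget : List V → List Entry → ℕ
  budget S σ = sum (map (#unused σ) S)

  budget-mono : ∀ S e σ → budget S (e ∷ σ) ℕ.≤ budget S σ
  budget-mono []      e σ = z≤n
  budget-mono (v ∷ S) e σ = ℕ.+-mono-≤ (#unused-mono e σ v) (budget-mono S e σ)

  budget-strict : ∀ {S σ v k a} → v ∈ S → Unused σ v a → budget S ((v , k , a) ∷ σ) ℕ.< budget S σ
  budget-strict {S = v ∷ S} {σ} {k = k} {a} (here refl) un =
    ℕ.+-mono-<-≤ (#unused-strict {k = k} un) (budget-mono S (v , k , a) σ)
  budget-strict {S = w ∷ S} {σ} {v} {k} {a} (there v∈S) un =
    ℕ.+-mono-≤-< (#unused-mono (v , k , a) σ w) (budget-strict {k = k} v∈S un)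

  -- One stage: a discovery followed by excursions.

  module Stage {q : ℚ} (0≤q : 0ℚ ≤ q) (ih : ∀ {S σ v t} → State S σ v t → CondProb≤ S σ q) where

    -- Survival bound when `j` favourable labels in a row, each of conditional probability at least
    -- 1/d, force a cycle; after any other outcome the bound `q` still applies.
    bound : ℕ → ℚ
    bound j = q * (1ℚ - pow (inv d) j)

    0≤bound : ∀ j → 0ℚ ≤ bound j
    0≤bound j = 0≤* 0≤q (0≤p-q (inv-d^≤1 j))

    favour : ∀ j {S σ v t} → State S σ v t → (a₀ : ArcFrom v) → Unused σ v a₀ →
      (∀ {S′} → State S′ ((v , port v t , a₀) ∷ σ) (proj₁ a₀) (suc t) → CondProb≤ S′ ((v , port v t , a₀) ∷ σ) (bound j)) →
      CondProb≤ S σ (bound (suc j))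
    favour j {σ = σ} {v} {t} st a₀ un₀ c with (v , port v t) ∈ˢ? map slot σ
    ... | yes known = cycled st (0≤bound (suc j)) known
    ... | no new    = cond-reveal-favoured (visited st) new (ℕ.≤-reflexive (reg v)) 0≤q (0≤inv-d^ j) (inv-d^≤1 j) un₀
      (move st a₀ (0≤bound j) c) (λ {a} _ → move st a 0≤q ih)

    module Excursions {p u} (pu : Adj p u) (t₁ : ℕ) where

      up : Adj u p
      up = Adj-sym pu

      -- t₁ + d′ stands for t₁ - 1 (mod d).
      κ : Fin (deg u)
      κ = port u (t₁ ℕ.+ d′)

      record Fresh (σ : List Entry) : Set where
        field
          entered  : (p , port p t₁) ∈ map slot σ
          p-unused : Unused σ u (p , up)
          κ-new    : (u , κ) ∉ map slot σ
          returned : ∀ {w wu} → (w , u , wu) ∈ map arc σ → w ≡ p ⊎ ∃[ uw ] (u , w , uw) ∈ map arc σ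

      open Fresh

      κ-closes : ∀ {t} → port u t ≡ κ → port p (suc t) ≡ port p t₁
      κ-closes {t} eq = port-cong p (begin
        (toℕ ℓ ℕ.+ suc t) % d             ≡⟨ cong (_% d) (ℕ.+-suc (toℕ ℓ) t) ⟩
        suc (toℕ ℓ ℕ.+ t) % d             ≡⟨ %-suc (toℕ ℓ ℕ.+ t) (toℕ ℓ ℕ.+ (t₁ ℕ.+ d′)) d
                                               (trans (sym (toℕ-port u t)) (trans (cong toℕ eq) (toℕ-port u (t₁ ℕ.+ d′)))) ⟩
        suc (toℕ ℓ ℕ.+ (t₁ ℕ.+ d′)) % d   ≡⟨ cong (λ x → suc x % d) (ℕ.+-assoc (toℕ ℓ) t₁ d′) ⟨
        suc (toℕ ℓ ℕ.+ t₁ ℕ.+ d′) % d     ≡⟨ cong (_% d) (ℕ.+-suc (toℕ ℓ ℕ.+ t₁) d′) ⟨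
        (toℕ ℓ ℕ.+ t₁ ℕ.+ d) % d          ≡⟨ [m+n]%n≡m%n (toℕ ℓ ℕ.+ t₁) d ⟩
        (toℕ ℓ ℕ.+ t₁) % d                ∎)
        where open ≡-Reasoning

      -- After `d′` excursions of two steps the time is t₁ + 1 + 2d′ = (t₁ + d′) + d, so `κ` is due.
      last-port : ∀ {t} → t ℕ.+ 0 ≡ suc t₁ ℕ.+ d′ ℕ.* 2 → port u t ≡ κ
      last-port {t} eq = port-cong u (begin
        (toℕ ℓ ℕ.+ t) % d                       ≡⟨ cong (λ x → (toℕ ℓ ℕ.+ x) % d) (trans (sym (ℕ.+-identityʳ t)) eq) ⟩
        (toℕ ℓ ℕ.+ (suc t₁ ℕ.+ d′ ℕ.* 2)) % d   ≡⟨ cong (_% d) (ring (toℕ ℓ) t₁ d′) ⟩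
        (toℕ ℓ ℕ.+ (t₁ ℕ.+ d′) ℕ.+ d) % d       ≡⟨ [m+n]%n≡m%n (toℕ ℓ ℕ.+ (t₁ ℕ.+ d′)) d ⟩
        (toℕ ℓ ℕ.+ (t₁ ℕ.+ d′)) % d             ∎)
        where
        open ≡-Reasoning
        ring : ∀ a b c → a ℕ.+ (suc b ℕ.+ c ℕ.* 2) ≡ a ℕ.+ (b ℕ.+ c) ℕ.+ suc c
        ring = solve-∀

      -- The favoured arc leads to `p`, where port t₁ is due again and has already been read. Any
      -- `j` is allowed, since `κ` may come up before all excursions are spent.
      close : ∀ j {S σ t} → State S σ u t → Fresh σ → port u t ≡ κ → CondProb≤ S σ (bound (suc j))
      close j {σ = σ} {t} st fr eq = favour j st (p , up) (p-unused fr) λ st′ → cycled st′ (0≤bound j)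
        (there (subst (λ k → (p , k) ∈ map slot σ) (sym (κ-closes {t} eq)) (entered fr)))

      return-fresh : ∀ {σ t w} (uw : Adj u w) {k} → Fresh σ → port u t ≢ κ → w ≢ p →
        Fresh ((w , k , u , Adj-sym uw) ∷ (u , port u t , w , uw) ∷ σ)
      return-fresh {σ} {t} {w} uw {k} fr t≢κ w≢p = record
        { entered  = there (there (entered fr))
        ; p-unused = λ { (here eq) → Adj-irrefl (cong proj₁ eq) uw
                       ; (there (here eq)) → w≢p (sym (cong (proj₁ ∘ proj₂) eq))
                       ; (there (there used)) → p-unused fr used }
        ; κ-new    = λ { (here eq) → Adj-irrefl (cong proj₁ eq) uw
                       ; (there (here eq)) → t≢κ (slot-injective (sym eq))
                       ; (there (there known)) → κ-new fr known }
        ; returned = λ { (here eq) → inj₂ (subst (λ x → ∃[ ux ] (u , x , ux) ∈ map arc σ′) (sym (cong proj₁ eq))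
                                               (uw , there (here refl)))
                       ; (there (here eq)) → ⊥-elim (Adj-irrefl (cong (proj₁ ∘ proj₂) eq) uw)
                       ; (there (there used)) → map₂ (λ { (uw′ , used′) → uw′ , there (there used′) }) (returned fr used) }
        }
        where
        σ′ : List Entry
        σ′ = (w , k , u , Adj-sym uw) ∷ (u , port u t , w , uw) ∷ σ
        slot-injective : ∀ {v} {j k : Fin (deg v)} → (v , j) ≡ (v , k) → j ≡ k
        slot-injective refl = refl

      -- Here `j` is the number of excursions left. Each needs two favourable labels, out and back,
      -- and the final step to `p` needs one more. The equation on `t` ensures that `κ` is due when
      -- none is left.
      excursions : ∀ j {S σ t} → State S σ u t → Fresh σ → t ℕ.+ j ℕ.* 2 ≡ suc t₁ ℕ.+ d′ ℕ.* 2 →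
        CondProb≤ S σ (bound (suc (j ℕ.* 2)))
      excursions zero    st fr eq = close 0 st fr (last-port eq)
      excursions (suc j) {S} {σ} {t} st fr eq
        with port u t Fin.≟ κ | (u , port u t) ∈ˢ? map slot σ | Any.any? (λ a → ¬? (proj₁ a ≟ p)) (unused σ u)
      ... | yes t≡κ | _         | _     = close (suc j ℕ.* 2) st fr t≡κ
      ... | no _    | yes known | _     = cycled st (0≤bound (suc (suc j ℕ.* 2))) known
      ... | no t≢κ  | no new    | no ¬a = cond-impossible (0≤bound (suc (suc j ℕ.* 2))) λ L Lσ _ →
        t≢κ (from-injective L u (trans (only-p (label-unused {L} Lσ new)) (sym (only-p (label-unused {L} Lσ (κ-new fr))))))
        where
        -- Ports port u t and κ of u are both unrevealed, so they cannot both lead to p.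
        only-p : ∀ {a} → Unused σ u a → a ≡ (p , up)
        only-p {w , uw} un with w ≟ p
        ... | yes refl = cong (p ,_) (Adj-irrelevant uw up)
        ... | no w≢p   = contradiction (lose (∈-unused {σ} un) w≢p) ¬a
      ... | no t≢κ  | no new    | yes ∃a with find ∃a
      ...   | (w , uw) , a∈ , w≢p = favour (suc (suc (j ℕ.* 2))) st (w , uw) un λ st′ →
        favour (suc (j ℕ.* 2)) st′ (u , Adj-sym uw) back-unused λ st″ →
          excursions j st″ (return-fresh {t = t} uw fr t≢κ w≢p) (trans (sym (shift t (j ℕ.* 2))) eq)
        where
        un : Unused σ u (w , uw)
        un = proj₂ (∈-filter⁻ (unused? σ u) {xs = allArcs u} a∈)
        back-unused : Unused ((u , port u t , w , uw) ∷ σ) w (u , Adj-sym uw)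
        back-unused (here eq) = Adj-irrefl (sym (cong proj₁ eq)) uw
        back-unused (there used) with returned fr used
        ... | inj₁ w≡p         = w≢p w≡p
        ... | inj₂ (uw′ , used′) = un (subst (λ x → (u , w , x) ∈ map arc σ) (Adj-irrelevant uw′ uw) used′)
        shift : ∀ a b → a ℕ.+ suc (suc b) ≡ suc (suc a) ℕ.+ b
        shift = solve-∀

    -- Before its discovery `w` is neither source nor target of an entry, so the new arc into `w` is
    -- the only one in the extended list that touches it.
    discover-fresh : ∀ {S σ v t w} → State S σ v t → (vw : Adj v w) → w ∉ S →
      Excursions.Fresh vw t ((v , port v t , w , vw) ∷ σ)
    discover-fresh {w = w} st vw w∉S = record
      { entered  = here refl
      ; p-unused = λ { (here eq) → Adj-irrefl (sym (cong proj₁ eq)) vw ; (there used) → no-source used }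
      ; κ-new    = λ { (here eq) → Adj-irrefl (sym (cong proj₁ eq)) vw
                     ; (there known) → w∉S (sources st (proj₂ (known-entry known))) }
      ; returned = λ { (here eq) → inj₁ (cong proj₁ eq) ; (there used) → ⊥-elim (no-target used) }
      }
      where
      no-source : ∀ {a} → (w , a) ∉ map arc _
      no-source used with ∈-map⁻ arc used
      ... | _ , e∈σ , refl = w∉S (sources st e∈σ)
      no-target : ∀ {v′ v′w} → (v′ , w , v′w) ∉ map arc _
      no-target used with ∈-map⁻ arc used
      ... | _ , e∈σ , refl = w∉S (targets st e∈σ)

    -- Until a discovery no label is favoured. Every step that stays among visited vertices uses up
    -- one of their arcs and lowers `budget`, so the walk discovers a vertex or cycles before the
    -- fuel runs out.
    stage : ∀ fuel {S σ v t} → State S σ v t → budget S σ ℕ.< fuel → CondProb≤ S σ (bound (suc (d′ ℕ.* 2)))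
    stage (suc fuel) {S} {σ} {v} {t} st (s≤s b≤fuel) with (v , port v t) ∈ˢ? map slot σ
    ... | yes known = cycled st (0≤bound (suc (d′ ℕ.* 2))) known
    ... | no new    = cond-reveal (visited st) new (0≤bound (suc (d′ ℕ.* 2))) step
      where
      step : ∀ {a} → Unused σ v a → CondProb≤ S ((v , port v t , a) ∷ σ) (bound (suc (d′ ℕ.* 2)))
      step {a@(w , vw)} un with w ∈ⱽ? S
      ... | yes w∈S = stage fuel (stay st a w∈S) (ℕ.<-≤-trans (budget-strict {k = port v t} (visited st) un) b≤fuel)
      ... | no w∉S  = cond-grow (0≤bound (suc (d′ ℕ.* 2)))
        -- The walk reaches `w` at time `suc t` with all `d′` excursions ahead, so the time equation
        -- is `refl`.
        (Excursions.excursions vw t d′ (discover st a w∉S) (discover-fresh st vw w∉S) refl)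

  -- Iterating the stages, and the theorem.

  δ : ℚ
  δ = pow (inv d) (suc (d′ ℕ.* 2))

  stages : ∀ n {S σ v t} → State S σ v t → CondProb≤ S σ (pow (1ℚ - δ) n)
  stages zero    st = cond-trivial (uniq st)
  -- The bound `q` is that of the remaining `n` stages, and the fuel is `suc` of the budget.
  stages (suc n) st = Stage.stage (0≤pow n (0≤p-q (inv-d^≤1 (suc (d′ ℕ.* 2))))) (stages n) _ st ℕ.≤-refl

  nonCycling-null : Null NonCycling
  nonCycling-null = null λ ε 0<ε →
    let n , δⁿ≤ε = pow-vanishes (0<pow (suc (d′ ℕ.* 2)) (0<inv d)) (inv-d^≤1 (suc (d′ ℕ.* 2))) 0<ε in
    cover-⊆ (λ L ¬cyc → [] , ¬cyc)
      (≤-trans (≤-reflexive (trans (cong (λ x → pow (1ℚ - δ) n * (1ℚ * x)) ι1≡1) (*-identityʳ (pow (1ℚ - δ) n)))) δⁿ≤ε)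
      -- Dropping `v₀` from the vertex list leaves the empty partial labeling over no vertices, of
      -- mass 1, so the conditional bound becomes an absolute one.
      (cover (cond-grow (0≤pow n (0≤p-q (inv-d^≤1 (suc (d′ ℕ.* 2))))) (stages n initial)))

theorem4p4 : (G : Graph) (LF : Graph.LocallyFinite G) (d : ℕ) →
    let open Graph G
        open LocallyFinite LF
        open BasicWalk G LF in
    Infinite V → Connected → Countable V → Regular d →
    (v₀ : V) (ℓ : Fin (deg v₀)) →
    WithProbabilityOne (λ L → Cycles L v₀ ℓ)
theorem4p4 G LF zero    _ _ _   reg v₀ ℓ = contradiction (subst Fin (reg v₀) ℓ) λ ()
-- The injection into ℕ makes equality of vertices decidable.
theorem4p4 G LF (suc d) _ _ V↣ℕ reg v₀ ℓ = Exploring.nonCycling-null G LF (via-injection V↣ℕ ℕ._≟_) d reg v₀ ℓ
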